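{- Let $A$ be a finite set of integers with smallest element $0$ and largest element $b\ge 1$, such that the gcd of the elements of $A$ is $1$. Let $N\ge 1$ be an integer with $N\geq 2\lfloor b/2\rfloor$. If $0 \leq n\leq Nb$ is an integer with $n\notin \mathcal E(A)\cup (Nb- \mathcal E(b-A))$, then $n\in NA$. Equivalently, $$NA = \{0 , 1,\ldots , bN\} \setminus \big(\mathcal E(A) \cup (bN - \mathcal E(b-A))\big).$$
   Context: $\mathbb N=\{0,1,2,\dots\}$. For an integer $N\ge1$, $NA=\{a_1+\cdots+a_N: a_1,\dots,a_N\in A\}$ (the $a_i$ not necessarily distinct). $\mathcal P(A)=\{\sum_{a\in A} n_a a: n_a\in\mathbb N\}$ and the exceptional set is $\mathcal E(A)=\mathbb N\setminus\mathcal P(A)$. $b-A=\{b-a:a\in A\}$, and $\mathcal E(b-A)$ is defined in the same way for the set $b-A$. For an integer $m$ and a set $X$, $m-X=\{m-x:x\in X\}$. -}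

module Defs where

open import Data.Nat using (ℕ; _+_; _*_; _∸_)
open import Data.Nat.GCD using (gcd)
open import Data.List using (List; length; zipWith; map; foldr)
open import Data.Nat.ListAction using (sum)
open import Data.List.Relation.Unary.All using (All)
open import Data.List.Membership.Propositional using (_∈_)
open import Data.Product using (Σ; _×_)
open import Relation.Binary.PropositionalEquality using (_≡_)
open import Relation.Nullary using (¬_)

-- A finite set of naturals is represented by a list of its elements.

gcdList : List ℕ → ℕ
gcdList = foldr gcd 0

InSumset : ℕ → List ℕ → ℕ → Set
InSumset N A n = Σ (List ℕ) λ xs → length xs ≡ N × All (_∈ A) xs × sum xs ≡ n

InP : List ℕ → ℕ → Set
InP A n = Σ (List ℕ) λ cs → length cs ≡ length A × sum (zipWith _*_ cs A) ≡ n

InE : List ℕ → ℕ → Set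
InE A n = ¬ InP A n

shift : ℕ → List ℕ → List ℕ
shift b A = map (b ∸_) A

-- n ∈ m - X  iff  n = m - x for some x ∈ X (as integers; here n ≥ 0)
InReflect : ℕ → (ℕ → Set) → ℕ → Set
InReflect m X n = Σ ℕ λ x → X x × x + n ≡ m

{-# OPTIONS --safe #-}

-- Write m = N b - n and call a multiset z of elements of A strictly between 0 and b a box
-- point when Σ z ≡ n (mod b), Σ z ≤ n and Σ (b - z) ≤ m; padding a box point with copies of
-- 0 and b exhibits n ∈ N A. The hypotheses give multisets P with Σ P ≤ n and Q with
-- Σ (b - Q) ≤ m, both of sum ≡ n.
--
-- If Σ x ≤ n < Σ y and Σ (b - x) > m for two multisets x, y of sum ≡ n, then
-- Σ y ≥ n + b and Σ (b - x) ≥ m + b, so Σ y + Σ (b - x) ≥ (N + 2) b. This settles the case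
-- |P|, |Q| ≤ b/2.
--
-- Take P minimal for (Σ P, |P|). Two congruent sub-multisets, say t copies of the least
-- element v of P and some multiset W of larger elements of P, could be exchanged to make P
-- smaller. So the multiplicity y of v satisfies (y + 1)(|P| - y + 1) ≤ b, whence |P| ≤ b/2,
-- unless P is cyclic, i.e. consists of k copies of a single w, which one may then take invertible mod b.
-- The reflection a ↦ b - a gives the same dichotomy for Q and lets us assume that P is cyclic.
--
-- In the latter case write Q = (q₁, q₂, …), and let s t be the residue such that
-- Z t = {q₁, …, q_t} ∪ {s t copies of w} has sum ≡ n. Unless Q can be shortened, the s t are
-- distinct, so if t′ > t are the positions of consecutive record minima of s, then
-- t′ + s t ≤ b and the inequality above applies to the pair (Z t, Z t′): if Z t is not a box
-- point then Σ (Z t′) ≤ n. At the last record s t = 0 and Z t ⊆ Q, so Z t is a box point.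

module Submission where

open import Defs
open import Data.Nat hiding (compare)
open import Data.Nat.Properties
open import Data.Nat.DivMod
open import Data.Nat.Divisibility using (divides)
open import Data.Nat.GCD using (gcd; gcd[m,n]∣m; gcd[m,n]∣n; module Bézout)
open import Data.Nat.Coprimality using (gcd≡1⇒coprime; coprime-Bézout)
open import Data.Nat.ListAction using (sum)
open import Data.Nat.ListAction.Properties using (sum-++)
open import Data.Nat.Tactic.RingSolver using (solve-∀)
open import Data.Fin using (Fin; toℕ; fromℕ<; remQuot; combine)
open import Data.Fin.Properties as Fin
  using (pigeonhole; combine-remQuot; toℕ-injective; toℕ<n; fromℕ<-injective)
open import Data.List using (List; []; _∷_; _++_; length; replicate; take; drop; map; zipWith)
open import Data.List.Properties
  using (length-++; length-replicate; length-take; length-drop; take++drop≡id; take-take;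
         take-all; map-++; map-replicate)
open import Data.List.Relation.Unary.All as All using (All; []; _∷_)
open import Data.List.Relation.Unary.All.Properties using (++⁺; replicate⁺; take⁺; drop⁺; map⁺)
open import Data.List.Relation.Unary.Any as Any using (Any; here; there)
open import Data.List.Membership.Propositional using (_∈_; find; lose)
open import Data.List.Membership.Propositional.Properties using (∈-map⁺)
open import Data.Product using (∃; ∃₂; _×_; _,_; proj₁; proj₂; uncurry)
open import Data.Sum using (_⊎_; inj₁; inj₂)
open import Function using (_∘_)
open import Relation.Binary.Definitions using (tri<; tri≈; tri>)
open import Relation.Binary.PropositionalEquality
open import Relation.Nullary using (¬_; Dec; contradiction; _×-dec_; decidable-stable)
open import Relation.Nullary.Decidable using (map′)

-- Congruence modulo `b` on the natural numbers.

module Congruence (b : ℕ) .{{_ : NonZero b}} where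

  infix 4 _≈_

  -- Multiples of `b` are added on both sides, which avoids subtraction in ℕ.
  data _≈_ (x y : ℕ) : Set where
    congruent : ∀ s t → x + s * b ≡ y + t * b → x ≈ y

  ≈-refl : ∀ {x} → x ≈ x
  ≈-refl = congruent 0 0 refl

  ≈-reflexive : ∀ {x y} → x ≡ y → x ≈ y
  ≈-reflexive refl = ≈-refl

  ≈-sym : ∀ {x y} → x ≈ y → y ≈ x
  ≈-sym (congruent s t e) = congruent t s (sym e)

  ≈-trans : ∀ {x y z} → x ≈ y → y ≈ z → x ≈ z
  ≈-trans {x} {y} {z} (congruent s t e) (congruent s′ t′ e′) = congruent (s + s′) (t′ + t) (begin
    x + (s + s′) * b       ≡⟨ regroup x s s′ b ⟩
    (x + s * b) + s′ * b   ≡⟨ cong (_+ s′ * b) e ⟩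
    (y + t * b) + s′ * b   ≡⟨ swap y t s′ b ⟩
    (y + s′ * b) + t * b   ≡⟨ cong (_+ t * b) e′ ⟩
    (z + t′ * b) + t * b   ≡⟨ regroup z t′ t b ⟨
    z + (t′ + t) * b       ∎)
    where
    open ≡-Reasoning
    regroup : ∀ x s t b → x + (s + t) * b ≡ (x + s * b) + t * b
    regroup = solve-∀
    swap : ∀ y t s b → (y + t * b) + s * b ≡ (y + s * b) + t * b
    swap = solve-∀

  ≈-+ : ∀ {x y x′ y′} → x ≈ y → x′ ≈ y′ → x + x′ ≈ y + y′
  ≈-+ {x} {y} {x′} {y′} (congruent s t e) (congruent s′ t′ e′) = congruent (s + s′) (t + t′)
    (trans (regroup x x′ s s′ b) (trans (cong₂ _+_ e e′) (sym (regroup y y′ t t′ b))))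
    where
    regroup : ∀ x x′ s s′ b → x + x′ + (s + s′) * b ≡ (x + s * b) + (x′ + s′ * b)
    regroup = solve-∀

  ≈-*ʳ : ∀ {x y} c → x ≈ y → x * c ≈ y * c
  ≈-*ʳ {x} {y} c (congruent s t e) = congruent (s * c) (t * c)
    (trans (regroup x s c b) (trans (cong (_* c) e) (sym (regroup y t c b))))
    where
    regroup : ∀ x s c b → x * c + s * c * b ≡ (x + s * b) * c
    regroup = solve-∀

  ≈-cancelʳ : ∀ {x y z z′} → z ≈ z′ → x + z ≈ y + z′ → x ≈ y
  ≈-cancelʳ {x} {y} {z} {z′} (congruent s t e) (congruent s′ t′ e′) =
    congruent (s′ + t) (t′ + s) (+-cancelʳ-≡ (z + z′) _ _ (begin
      x + (s′ + t) * b + (z + z′)        ≡⟨ regroup x s′ t b z z′ ⟩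
      (x + z + s′ * b) + (z′ + t * b)    ≡⟨ cong₂ _+_ e′ (sym e) ⟩
      (y + z′ + t′ * b) + (z + s * b)    ≡⟨ regroup y t′ s b z′ z ⟨
      y + (t′ + s) * b + (z′ + z)        ≡⟨ cong (y + (t′ + s) * b +_) (+-comm z′ z) ⟩
      y + (t′ + s) * b + (z + z′)        ∎))
    where
    open ≡-Reasoning
    regroup : ∀ x s t b z z′ → x + (s + t) * b + (z + z′) ≡ (x + z + s * b) + (z′ + t * b)
    regroup = solve-∀

  multiple≈0 : ∀ k → k * b ≈ 0
  multiple≈0 k = congruent 0 k (+-identityʳ _)

  ≈-opposite : ∀ {x y x′ y′} → x ≈ x′ → x + y ≈ 0 → x′ + y′ ≈ 0 → y ≈ y′
  ≈-opposite {x} {y} {x′} {y′} x≈x′ p q = ≈-cancelʳ x≈x′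
    (≈-trans (≈-reflexive (+-comm y x)) (≈-trans p (≈-trans (≈-sym q) (≈-reflexive (+-comm x′ y′)))))

  %-≈ : ∀ x → x % b ≈ x
  %-≈ x = congruent (x / b) 0 (trans (sym (m≡m%n+[m/n]*n x b)) (sym (+-identityʳ x)))

  %≡⇒≈ : ∀ {x y} → x % b ≡ y % b → x ≈ y
  %≡⇒≈ {x} {y} e = ≈-trans (≈-sym (%-≈ x)) (≈-trans (≈-reflexive e) (%-≈ y))

  ≈⇒%≡ : ∀ {x y} → x ≈ y → x % b ≡ y % b
  ≈⇒%≡ {x} {y} (congruent s t e) =
    trans (sym ([m+kn]%n≡m%n x s b)) (trans (cong (_% b) e) ([m+kn]%n≡m%n y t b))

  -- The witness `j` later counts the copies of `b` or of 0 used as padding.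
  ≈∧≤⇒+ : ∀ {x y} → x ≈ y → x ≤ y → ∃ λ j → x + j * b ≡ y
  ≈∧≤⇒+ {x} {y} x≈y x≤y = d / b , (begin
    x + d / b * b            ≡⟨ cong (λ r → x + (r + d / b * b)) d%b≡0 ⟨
    x + (d % b + d / b * b)  ≡⟨ cong (x +_) (m≡m%n+[m/n]*n d b) ⟨
    x + d                    ≡⟨ m+[n∸m]≡n x≤y ⟩
    y                        ∎)
    where
    open ≡-Reasoning
    d = y ∸ x
    d%b≡0 : d % b ≡ 0
    d%b≡0 = trans (≈⇒%≡ (≈-cancelʳ x≈y (≈-reflexive (m∸n+n≡m x≤y)))) (m*n%n≡0 0 b)

  ≈∧<⇒+≤ : ∀ {x y} → x ≈ y → x < y → x + b ≤ y
  ≈∧<⇒+≤ {x} x≈y x<y with ≈∧≤⇒+ x≈y (<⇒≤ x<y)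
  ... | zero  , e = contradiction (trans (sym (+-identityʳ x)) e) (<⇒≢ x<y)
  ... | suc j , e = ≤-trans (+-monoʳ-≤ x (m≤m+n b (j * b))) (≤-reflexive e)

-- Sums and lengths of prefixes, windows and cuts of a list.

sum-replicate : ∀ k w → sum (replicate k w) ≡ k * w
sum-replicate zero    w = refl
sum-replicate (suc k) w = cong (w +_) (sum-replicate k w)

sum-replicate-++ : ∀ k w xs → sum (replicate k w ++ xs) ≡ k * w + sum xs
sum-replicate-++ k w xs = trans (sum-++ (replicate k w) xs) (cong (_+ sum xs) (sum-replicate k w))

sum-take+drop : ∀ i xs → sum (take i xs) + sum (drop i xs) ≡ sum xs
sum-take+drop i xs = trans (sym (sum-++ (take i xs) (drop i xs))) (cong sum (take++drop≡id i xs))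

-- A difference of two prefixes: a coincidence between prefix sums becomes a statement about a
-- window.
window : ℕ → ℕ → List ℕ → List ℕ
window i j xs = drop i (take j xs)

sum-window : ∀ {i j} xs → i ≤ j → sum (take i xs) + sum (window i j xs) ≡ sum (take j xs)
sum-window {i} {j} xs i≤j = trans
  (cong (λ ys → sum ys + sum (window i j xs))
    (sym (trans (take-take i j xs) (cong (λ k → take k xs) (m≤n⇒m⊓n≡m i≤j)))))
  (sum-take+drop i (take j xs))

length-window : ∀ {i j} xs → j ≤ length xs → length (window i j xs) ≡ j ∸ i
length-window {i} {j} xs j≤ = trans (length-drop i (take j xs))
  (cong (_∸ i) (trans (length-take j xs) (m≤n⇒m⊓n≡m j≤)))

cut : ℕ → ℕ → List ℕ → List ℕ
cut i j xs = take i xs ++ drop j xs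

cut⁺ : ∀ {P : ℕ → Set} {xs} i j → All P xs → All P (cut i j xs)
cut⁺ i j ps = ++⁺ (take⁺ i ps) (drop⁺ j ps)

sum-cut : ∀ {i j} xs → i ≤ j → sum (cut i j xs) + sum (window i j xs) ≡ sum xs
sum-cut {i} {j} xs i≤j = begin
  sum (cut i j xs) + W             ≡⟨ cong (_+ W) (sum-++ (take i xs) (drop j xs)) ⟩
  sum (take i xs) + D + W          ≡⟨ +-assoc (sum (take i xs)) D W ⟩
  sum (take i xs) + (D + W)        ≡⟨ cong (sum (take i xs) +_) (+-comm D W) ⟩
  sum (take i xs) + (W + D)        ≡⟨ +-assoc (sum (take i xs)) W D ⟨
  sum (take i xs) + W + D          ≡⟨ cong (_+ D) (sum-window xs i≤j) ⟩
  sum (take j xs) + D              ≡⟨ sum-take+drop j xs ⟩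
  sum xs                           ∎
  where
  open ≡-Reasoning
  W = sum (window i j xs)
  D = sum (drop j xs)

-- Used with `v` = 0 for positivity of a window, and with `v` the least element to compare lengths
-- in an exchange.
length-*≤sum : ∀ {v xs} → All (v <_) xs → length xs * suc v ≤ sum xs
length-*≤sum []         = z≤n
length-*≤sum (v<x ∷ ps) = +-mono-≤ v<x (length-*≤sum ps)

length-cut< : ∀ {i j} xs → i < j → j ≤ length xs → length (cut i j xs) < length xs
length-cut< {i} {j} xs i<j j≤ = begin-strict
  length (cut i j xs)                     ≡⟨ length-++ (take i xs) ⟩
  length (take i xs) + length (drop j xs)
    ≡⟨ cong₂ _+_ (trans (length-take i xs) (m≤n⇒m⊓n≡m (≤-trans (<⇒≤ i<j) j≤))) (length-drop j xs) ⟩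
  i + (length xs ∸ j)                     <⟨ +-monoˡ-< (length xs ∸ j) i<j ⟩
  j + (length xs ∸ j)                     ≡⟨ m+[n∸m]≡n j≤ ⟩
  length xs                               ∎
  where open ≤-Reasoning

-- Splitting off the least element, and pigeonhole on a grid.

-- The multiplicity of `least` is `suc copies`. The original list is remembered only through its sum
-- and its length, the two quantities that the descent measures.
record MinSplit (S : ℕ → Set) (xs : List ℕ) : Set where
  constructor minSplit
  field
    {least} : ℕ
    copies  : ℕ
    {rest}  : List ℕ
    least∈S : S least
    rest⊆S  : All S rest
    least<  : All (least <_) rest
    sum≡    : sum xs ≡ suc copies * least + sum rest
    length≡ : length xs ≡ suc copies + length rest

min-split : ∀ {S : ℕ → Set} {x xs} → All S (x ∷ xs) → MinSplit S (x ∷ xs)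
min-split {x = x} {[]} (px ∷ []) = minSplit 0 px [] [] (cong (_+ 0) (sym (+-identityʳ x))) refl
min-split {x = x} {y ∷ ys} (px ∷ ps) with min-split ps
... | minSplit {v} c {r} pv pr v<r s≡ l≡ with <-cmp x v
... | tri< x<v _ _ = minSplit 0 px (pv ∷ ++⁺ (replicate⁺ c pv) pr)
  (x<v ∷ ++⁺ (replicate⁺ c x<v) (All.map (<-trans x<v) v<r))
  (cong₂ _+_ (sym (+-identityʳ x)) (trans s≡
    (trans (+-assoc v (c * v) (sum r)) (cong (v +_) (sym (sum-replicate-++ c v r))))))
  (cong suc (trans l≡ (cong suc (sym (trans (length-++ (replicate c v)) (cong (_+ length r) (length-replicate c)))))))
... | tri≈ _ refl _ = minSplit (suc c) pv pr v<r
  (trans (cong (x +_) s≡) (sym (+-assoc x (suc c * x) (sum r)))) (cong suc l≡)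
... | tri> _ _ v<x = minSplit c pv (px ∷ pr) (v<x ∷ v<r)
  (trans (cong (x +_) s≡) (left-comm x (suc c * v) (sum r)))
  (trans (cong suc l≡) (sym (+-suc (suc c) (length r))))
  where
  left-comm : ∀ x y z → x + (y + z) ≡ y + (x + z)
  left-comm = solve-∀

grid-pigeonhole : ∀ {b} m n → b < m * n → (f : Fin m → Fin n → Fin b) →
  ∃₂ λ i s → ∃₂ λ j t → ¬ (i ≡ j × s ≡ t) × f i s ≡ f j t
grid-pigeonhole m n b<mn f with pigeonhole b<mn (uncurry f ∘ remQuot {m} n)
... | z , z′ , z<z′ , e = _ , _ , _ , _ , distinct , e
  where
  distinct : ¬ (proj₁ (remQuot {m} n z) ≡ proj₁ (remQuot {m} n z′) ×
                proj₂ (remQuot {m} n z) ≡ proj₂ (remQuot {m} n z′))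
  distinct (p , q) = Fin.<⇒≢ z<z′ (trans (sym (combine-remQuot {m} n z))
    (trans (cong₂ combine p q) (combine-remQuot {m} n z′)))

-- Reduction of a multiset to a short or a cyclic one.

module Reduction (b : ℕ) .{{_ : NonZero b}} where

  open Congruence b

  Invertible : ℕ → Set
  Invertible w = ∃ λ x → w * x ≈ 1

  coprime⇒invertible : ∀ {w} → gcd w b ≡ 1 → Invertible w
  coprime⇒invertible {w} e with coprime-Bézout (gcd≡1⇒coprime e)
  ... | Bézout.+- x y eq = x , ≈-trans (≈-reflexive (trans (*-comm w x) (sym eq)))
    (congruent 0 y (+-identityʳ _))
  -- Here `x * w` is congruent to -1, so its square `w * (w * x * x)` is congruent to 1.
  ... | Bézout.-+ x y eq = w * x * x , ≈-opposite ≈-refl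
    (≈-trans (≈-reflexive (expand w x)) (≈-*ʳ (x * w) 1+xw≈0))
    (≈-trans (≈-reflexive (+-comm (x * w) 1)) 1+xw≈0)
    where
    1+xw≈0 : 1 + x * w ≈ 0
    1+xw≈0 = ≈-trans (≈-reflexive eq) (multiple≈0 y)
    expand : ∀ w x → x * w + w * (w * x * x) ≡ (1 + x * w) * (x * w)
    expand = solve-∀

  module _ (S : ℕ → Set) where

    -- The target `y` may be undershot by a multiple of `b`, which padding restores at the end.
    Short : ℕ → Set
    Short y = ∃ λ xs → All S xs × sum xs ≤ y × sum xs ≈ y × 2 * length xs ≤ b

    Cyclic : ℕ → Set
    Cyclic y = ∃₂ λ w k → S w × k * w ≤ y × k * w ≈ y × Invertible w

    -- If g = gcd(w, b) ≥ 2, then `w` has order `e` = b / g ≤ b / 2 modulo `b`, so `k % e` copies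
    -- suffice and form a short list. If g = 1, then `w` is invertible.
    replicate-reduce : ∀ {w} k → S w → Short (k * w) ⊎ Cyclic (k * w)
    replicate-reduce {w} k pw with gcd w b in eq | gcd[m,n]∣m w b | gcd[m,n]∣n w b
    ... | 0 | _ | divides e b≡ = contradiction (trans b≡ (*-zeroʳ e)) (≢-nonZero⁻¹ b)
    ... | 1 | _ | _ = inj₂ (w , k , pw , ≤-refl , ≈-refl , coprime⇒invertible {w} eq)
    ... | suc (suc d) | divides q w≡ | divides e b≡ = inj₁
      (replicate r w , replicate⁺ r pw ,
        ≤-trans (≤-reflexive (sum-replicate r w)) (*-monoˡ-≤ w (m%n≤m k e)) ,
        ≈-trans (≈-reflexive (sum-replicate r w)) rw≈kw ,
        (begin
          2 * length (replicate r w)   ≡⟨ cong (2 *_) (length-replicate r) ⟩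
          2 * r                        ≤⟨ *-mono-≤ (s≤s (s≤s (z≤n {d}))) (<⇒≤ (m%n<n k e)) ⟩
          suc (suc d) * e              ≡⟨ *-comm (suc (suc d)) e ⟩
          e * suc (suc d)              ≡⟨ b≡ ⟨
          b                            ∎))
      where
      open ≤-Reasoning
      instance
        e≢0 : NonZero e
        e≢0 = ≢-nonZero λ { refl → ≢-nonZero⁻¹ b b≡ }
      r = k % e
      rw≈kw : r * w ≈ k * w
      rw≈kw = congruent (k / e * q) 0 (trans rw+≡kw (sym (+-identityʳ (k * w))))
        where
        regroup : ∀ r p q e d → r * (q * d) + p * q * (e * d) ≡ (r + p * e) * (q * d)
        regroup = solve-∀
        rw+≡kw : r * w + k / e * q * b ≡ k * w
        rw+≡kw = trans (cong₂ (λ w b → r * w + k / e * q * b) w≡ b≡)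
          (trans (regroup r (k / e) q e (suc (suc d)))
            (cong₂ _*_ (sym (m≡m%n+[m/n]*n k e)) (sym w≡)))

    -- A descent step for the lexicographic order on (sum, length) that preserves the residue.
    Smaller : ℕ → ℕ → Set
    Smaller y l = ∃ λ xs → All S xs × sum xs ≤ y × sum xs ≈ y ×
      (sum xs < y ⊎ length xs < l)

    -- The multiset being reduced is `y` copies of its least element `v` together with the larger
    -- elements `O`. A pair (i, s) stands for the first `i` entries of `O` and `s` copies of `v`.
    module _ (S>0 : ∀ {a} → S a → 0 < a) {v O} (y : ℕ) (pv : S v) (pO : All S O) (v<O : All (v <_) O) where

      -- The two pairs are nested, so their difference is a nonempty sub-multiset of sum ≡ 0;
      -- removing it lowers the sum because all elements are positive.
      drop-zero-sum : ∀ {i j s t} → i ≤ j → j ≤ length O → s ≤ t → t ≤ y → ¬ (i ≡ j × s ≡ t) →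
        sum (take i O) + s * v ≈ sum (take j O) + t * v →
        Smaller (y * v + sum O) (y + length O)
      drop-zero-sum {i} {j} {s} {t} i≤j j≤ s≤t t≤y ne eq =
        replicate (y ∸ T) v ++ cut i j O ,
        ++⁺ (replicate⁺ (y ∸ T) pv) (cut⁺ i j pO) ,
        ≤-trans (m≤m+n new (σ + T * v)) (≤-reflexive new+) ,
        ≈-cancelʳ σ+Tv≈0 (≈-reflexive (trans new+ (sym (+-identityʳ _)))) ,
        inj₁ (≤-trans (m<m+n new positive) (≤-reflexive new+))
        where
        T = t ∸ s
        σ = sum (window i j O)
        new = sum (replicate (y ∸ T) v ++ cut i j O)
        new+ : new + (σ + T * v) ≡ y * v + sum O
        new+ = trans (cong (_+ (σ + T * v)) (sum-replicate-++ (y ∸ T) v (cut i j O)))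
          (trans (regroup (y ∸ T) T v (sum (cut i j O)) σ)
            (cong₂ (λ p q → p * v + q) (m∸n+n≡m (≤-trans (m∸n≤m t s) t≤y)) (sum-cut O i≤j)))
          where
          regroup : ∀ c T v k σ → c * v + k + (σ + T * v) ≡ (c + T) * v + (k + σ)
          regroup = solve-∀
        σ+Tv≈0 : σ + T * v ≈ 0
        σ+Tv≈0 = ≈-sym (≈-cancelʳ (≈-refl {sum (take i O) + s * v}) (≈-trans eq (≈-reflexive
          (trans (cong₂ (λ p q → p + q * v) (sym (sum-window O i≤j)) (sym (m∸n+n≡m s≤t)))
            (regroup (sum (take i O)) σ T s v)))))
          where
          regroup : ∀ p σ T s v → p + σ + (T + s) * v ≡ σ + T * v + (p + s * v)
          regroup = solve-∀
        positive : 0 < σ + T * v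
        positive with m≤n⇒m<n∨m≡n i≤j | m≤n⇒m<n∨m≡n s≤t
        ... | inj₁ i<j | _ = ≤-trans (≤-trans (m<n⇒0<n∸m i<j) (≤-trans
          (≤-reflexive (trans (sym (length-window {i} O j≤)) (sym (*-identityʳ _))))
          (length-*≤sum (drop⁺ i (take⁺ j (All.map S>0 pO)))))) (m≤m+n σ (T * v))
        ... | inj₂ _ | inj₁ s<t = ≤-trans (*-mono-≤ (m<n⇒0<n∸m s<t) (S>0 pv)) (m≤n+m (T * v) σ)
        ... | inj₂ p | inj₂ q = contradiction (p , q) ne

      -- The pairs cross, so `T` copies of `v` are congruent to the window `W`. Whichever has the
      -- larger sum is replaced by the other; on a tie `W` replaces the copies of `v`, and it is
      -- shorter because its entries exceed `v`.
      exchange : ∀ {i s j t} → i ≤ j → t < s → s ≤ y →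
        sum (take i O) + s * v ≈ sum (take j O) + t * v →
        Smaller (y * v + sum O) (y + length O)
      exchange {i} {s} {j} {t} i≤j t<s s≤y eq = case
        where
        T = s ∸ t
        W = window i j O
        old = y * v + sum O
        Tv≈W : T * v ≈ sum W
        Tv≈W = ≈-cancelʳ (≈-refl {sum (take i O) + t * v}) (≈-trans (≈-reflexive
            (trans (regroup₁ (sum (take i O)) T t v)
              (cong (λ q → sum (take i O) + q * v) (m∸n+n≡m (<⇒≤ t<s)))))
          (≈-trans eq (≈-reflexive (trans (cong (_+ t * v) (sym (sum-window O i≤j)))
            (regroup₂ (sum (take i O)) (sum W) (t * v))))))
          where
          regroup₁ : ∀ p T t v → T * v + (p + t * v) ≡ p + (T + t) * v
          regroup₁ = solve-∀
          regroup₂ : ∀ p w q → p + w + q ≡ w + (p + q)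
          regroup₂ = solve-∀
        up down : List ℕ
        up = replicate (y + T) v ++ cut i j O
        down = replicate (y ∸ T) v ++ (O ++ W)
        up+ : sum up + sum W ≡ old + T * v
        up+ = trans (cong (_+ sum W) (sum-replicate-++ (y + T) v (cut i j O)))
          (trans (regroup y T v (sum (cut i j O)) (sum W))
            (cong (λ p → y * v + p + T * v) (sum-cut O i≤j)))
          where
          regroup : ∀ y T v k σ → (y + T) * v + k + σ ≡ y * v + (k + σ) + T * v
          regroup = solve-∀
        y-T+T : y ∸ T + T ≡ y
        y-T+T = m∸n+n≡m (≤-trans (m∸n≤m s t) s≤y)
        down+ : sum down + T * v ≡ old + sum W
        down+ = trans (cong (_+ T * v) (trans (sum-replicate-++ (y ∸ T) v (O ++ W))
            (cong ((y ∸ T) * v +_) (sum-++ O W))))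
          (trans (regroup (y ∸ T) T v (sum O) (sum W)) (cong (λ p → p * v + sum O + sum W) y-T+T))
          where
          regroup : ∀ c T v k σ → c * v + (k + σ) + T * v ≡ (c + T) * v + k + σ
          regroup = solve-∀
        length-down+ : length down + T ≡ y + length O + length W
        length-down+ = trans (cong (_+ T) (trans (length-++ (replicate (y ∸ T) v))
            (cong₂ _+_ (length-replicate (y ∸ T)) (length-++ O))))
          (trans (regroup (y ∸ T) T (length O) (length W)) (cong (λ p → p + length O + length W) y-T+T))
          where
          regroup : ∀ c T k σ → c + (k + σ) + T ≡ (c + T) + k + σ
          regroup = solve-∀
        decreases : ∀ {new old p q} → new + q ≡ old + p → p < q → new < old
        decreases {new} {old} {p} {q} e p<q =
          +-cancelʳ-< q new old (≤-<-trans (≤-reflexive e) (+-monoʳ-< old p<q))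
        down-Smaller : sum down ≤ old → (sum down < old ⊎ length down < y + length O) → Smaller old (y + length O)
        down-Smaller le lt = down , ++⁺ (replicate⁺ (y ∸ T) pv) (++⁺ pO (drop⁺ i (take⁺ j pO))) ,
          le , ≈-cancelʳ Tv≈W (≈-reflexive down+) , lt
        W<T : sum W ≡ T * v → length W < T
        W<T e = ≰⇒> λ T≤W → <⇒≱ (m<n+m (T * v) (m<n⇒0<n∸m t<s)) (begin
          T + T * v             ≡⟨ *-suc T v ⟨
          T * suc v             ≤⟨ *-monoˡ-≤ (suc v) T≤W ⟩
          length W * suc v      ≤⟨ length-*≤sum (drop⁺ i (take⁺ j v<O)) ⟩
          sum W                 ≡⟨ e ⟩
          T * v                 ∎)
          where open ≤-Reasoning
        case : Smaller old (y + length O)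
        case with <-cmp (sum W) (T * v)
        ... | tri< W<Tv _ _ = down-Smaller (<⇒≤ lt) (inj₁ lt)
          where lt = decreases down+ W<Tv
        ... | tri≈ _ W≡Tv _ = down-Smaller
          (≤-reflexive (+-cancelʳ-≡ (T * v) _ _ (trans down+ (cong (old +_) W≡Tv))))
          (inj₂ (decreases length-down+ (W<T W≡Tv)))
        ... | tri> _ _ Tv<W = up , ++⁺ (replicate⁺ (y + T) pv) (cut⁺ i j pO) ,
          <⇒≤ lt , ≈-cancelʳ (≈-sym Tv≈W) (≈-reflexive up+) , inj₁ lt
          where lt = decreases up+ Tv<W

      -- There are more pairs (i, s) than residues, so two pairs have congruent sums; they are
      -- either nested or crossing.
      improve : b < suc (length O) * suc y → Smaller (y * v + sum O) (y + length O)
      improve b< with grid-pigeonhole (suc (length O)) (suc y) b<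
        (λ i s → fromℕ< (m%n<n (sum (take (toℕ i) O) + toℕ s * v) b))
      ... | i , s , j , t , ne , e = compare (≤-total (toℕ i) (toℕ j))
        where
        eq : sum (take (toℕ i) O) + toℕ s * v ≈ sum (take (toℕ j) O) + toℕ t * v
        eq = %≡⇒≈ (fromℕ<-injective _ _ _ _ e)
        ≤len : (i : Fin (suc (length O))) → toℕ i ≤ length O
        ≤len i = s≤s⁻¹ (toℕ<n i)
        ≤y : (s : Fin (suc y)) → toℕ s ≤ y
        ≤y s = s≤s⁻¹ (toℕ<n s)
        compare : toℕ i ≤ toℕ j ⊎ toℕ j ≤ toℕ i → Smaller (y * v + sum O) (y + length O)
        compare (inj₁ i≤j) with ≤-<-connex (toℕ s) (toℕ t)
        ... | inj₁ s≤t = drop-zero-sum i≤j (≤len j) s≤t (≤y t)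
          (λ (p , q) → ne (toℕ-injective p , toℕ-injective q)) eq
        ... | inj₂ t<s = exchange i≤j t<s (≤y s) eq
        compare (inj₂ j≤i) with ≤-<-connex (toℕ t) (toℕ s)
        ... | inj₁ t≤s = drop-zero-sum j≤i (≤len i) t≤s (≤y s)
          (λ (p , q) → ne (toℕ-injective (sym p) , toℕ-injective (sym q))) (≈-sym eq)
        ... | inj₂ s<t = exchange j≤i s<t (≤y t) (≈-sym eq)

    module _ (S>0 : ∀ {a} → S a → 0 < a) where

      reduce-step : ∀ xs → All S xs → Smaller (sum xs) (length xs) ⊎ Short (sum xs) ⊎ Cyclic (sum xs)
      reduce-step [] _ = inj₂ (inj₁ ([] , [] , z≤n , ≈-refl , z≤n))
      reduce-step xs@(_ ∷ _) pxs with min-split pxs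
      ... | minSplit {v} c {[]} pv _ _ s≡ _ =
        inj₂ (subst (λ y → Short y ⊎ Cyclic y) (sym (trans s≡ (+-identityʳ _))) (replicate-reduce (suc c) pv))
      ... | minSplit {v} c {o ∷ O} pv pO v<O s≡ l≡ with ≤-<-connex (2 * length xs) b
      ... | inj₁ short = inj₂ (inj₁ (xs , pxs , ≤-refl , ≈-refl , short))
      -- With c + 1 copies of `v` and o + 1 larger elements there are (o + 2)(c + 2) pairs, which is
      -- twice the length plus c o, hence more than `b`.
      ... | inj₂ b<2k = inj₁ (subst₂ Smaller (sym s≡) (sym l≡) (improve S>0 (suc c) pv pO v<O
        (<-≤-trans b<2k (≤-trans (≤-reflexive (trans (cong (2 *_) l≡) (double c (length O))))
          (≤-trans (m≤m+n _ (c * length O)) (≤-reflexive (expand c (length O))))))))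
        where
        double : ∀ c o → 2 * (suc c + suc o) ≡ 4 + 2 * c + 2 * o
        double = solve-∀
        expand : ∀ c o → 4 + 2 * c + 2 * o + c * o ≡ suc (suc o) * suc (suc c)
        expand = solve-∀

      short-or-cyclic : ∀ {y} xs → All S xs → sum xs ≤ y → sum xs ≈ y → Short y ⊎ Cyclic y
      short-or-cyclic xs pxs xs≤y xs≈y = go (sum xs) (length xs) xs pxs xs≤y xs≈y ≤-refl ≤-refl
        where
        weaken : ∀ {y z} → y ≤ z → y ≈ z → Short y ⊎ Cyclic y → Short z ⊎ Cyclic z
        weaken y≤z y≈z (inj₁ (xs , p , le , eq , short)) =
          inj₁ (xs , p , ≤-trans le y≤z , ≈-trans eq y≈z , short)
        weaken y≤z y≈z (inj₂ (w , k , p , le , eq , inv)) =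
          inj₂ (w , k , p , ≤-trans le y≤z , ≈-trans eq y≈z , inv)
        go : ∀ s l {y} xs → All S xs → sum xs ≤ y → sum xs ≈ y → sum xs ≤ s → length xs ≤ l →
          Short y ⊎ Cyclic y
        go s l xs pxs le eq s≥ l≥ with reduce-step xs pxs
        ... | inj₂ done = weaken le eq done
        go zero l xs pxs le eq s≥ l≥ | inj₁ (_ , _ , _ , _ , inj₁ lt) = contradiction (≤-trans lt s≥) λ ()
        -- The sum has dropped, so the length bound restarts at the length of the new list.
        go (suc s) l xs pxs le eq s≥ l≥ | inj₁ (ys , pys , le′ , eq′ , inj₁ lt) =
          go s (length ys) ys pys (≤-trans le′ le) (≈-trans eq′ eq) (s≤s⁻¹ (≤-trans lt s≥)) ≤-refl
        go s zero xs pxs le eq s≥ l≥ | inj₁ (_ , _ , _ , _ , inj₂ lt) = contradiction (≤-trans lt l≥) λ ()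
        go s (suc l) xs pxs le eq s≥ l≥ | inj₁ (ys , pys , le′ , eq′ , inj₂ lt) =
          go s l ys pys (≤-trans le′ le) (≈-trans eq′ eq) (≤-trans le′ s≥) (s≤s⁻¹ (≤-trans lt l≥))

-- Box points and the walk along record minima.

sum-take-≤ : ∀ {i j} xs → i ≤ j → sum (take i xs) ≤ sum (take j xs)
sum-take-≤ {i} {j} xs i≤j = ≤-trans (m≤m+n _ (sum (window i j xs))) (≤-reflexive (sum-window xs i≤j))

module Chain (b : ℕ) .{{_ : NonZero b}} where

  open Congruence b
  open Reduction b

  cosum : List ℕ → ℕ
  cosum xs = sum (map (b ∸_) xs)

  cosum-++ : ∀ xs ys → cosum (xs ++ ys) ≡ cosum xs + cosum ys
  cosum-++ xs ys = trans (cong sum (map-++ (b ∸_) xs ys)) (sum-++ (map (b ∸_) xs) _)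

  cosum-replicate : ∀ k w → cosum (replicate k w) ≡ k * (b ∸ w)
  cosum-replicate k w = trans (cong sum (map-replicate (b ∸_) k w)) (sum-replicate k (b ∸ w))

  cosum+sum : ∀ {xs} → All (_≤ b) xs → cosum xs + sum xs ≡ length xs * b
  cosum+sum [] = refl
  cosum+sum {x ∷ xs} (x≤b ∷ ps) = trans (interchange (b ∸ x) (cosum xs) x (sum xs))
    (cong₂ _+_ (m∸n+n≡m x≤b) (cosum+sum ps))
    where
    interchange : ∀ p q r s → p + q + (r + s) ≡ p + r + (q + s)
    interchange = solve-∀

  cosum-map : ∀ {xs} → All (_≤ b) xs → cosum (map (b ∸_) xs) ≡ sum xs
  cosum-map []         = refl
  cosum-map (x≤b ∷ ps) = cong₂ _+_ (m∸[m∸n]≡n x≤b) (cosum-map ps)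

  cosum+sum≈0 : ∀ {xs} → All (_≤ b) xs → cosum xs + sum xs ≈ 0
  cosum+sum≈0 {xs} ps = ≈-trans (≈-reflexive (cosum+sum ps)) (multiple≈0 (length xs))

  Box : (ℕ → Set) → ℕ → ℕ → Set
  Box S n m = ∃ λ zs → All S zs × sum zs ≤ n × sum zs ≈ n × cosum zs ≤ m

  module _ (S : ℕ → Set) (S>0 : ∀ {a} → S a → 0 < a) (S<b : ∀ {a} → S a → a < b)
           {n m N : ℕ} (n+m≡ : n + m ≡ N * b) where

    -- Truncated subtraction gives 0 for `r` ≥ `b`, whereas members of `S` are positive.
    cosum-S≤b : ∀ {r} → S (b ∸ r) → r ≤ b
    cosum-S≤b {r} p = <⇒≤ (m∸n≢0⇒n<m (m<n⇒n≢0 (S>0 p)))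

    n+m≈0 : n + m ≈ 0
    n+m≈0 = ≈-trans (≈-reflexive n+m≡) (multiple≈0 N)

    -- Both `cosum zs` and `m` are negatives of `n` modulo `b`.
    cosum≈m : ∀ {zs} → All S zs → sum zs ≈ n → cosum zs ≈ m
    cosum≈m {zs} ps e = ≈-opposite e (≈-trans (≈-reflexive (+-comm (sum zs) (cosum zs)))
      (cosum+sum≈0 (All.map (<⇒≤ ∘ S<b) ps))) n+m≈0

    -- If both bounds failed, each quantity would overshoot by at least a full `b`, and the total
    -- would reach n + m + 2b = (2 + N) b.
    corner : ∀ {xs ys} → All S xs → sum xs ≈ n → sum ys ≈ n →
      sum ys + cosum xs < (2 + N) * b → cosum xs ≤ m ⊎ sum ys ≤ n
    corner {xs} {ys} pxs ex ey lt with ≤-<-connex (cosum xs) m | ≤-<-connex (sum ys) n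
    ... | inj₁ cosum≤m | _ = inj₁ cosum≤m
    ... | inj₂ _ | inj₁ sum≤n = inj₂ sum≤n
    ... | inj₂ m< | inj₂ n< = contradiction lt (≤⇒≯ (begin
      (2 + N) * b          ≡⟨ regroup N b ⟩
      (N * b + b) + b      ≡⟨ cong (λ p → p + b + b) n+m≡ ⟨
      n + m + b + b        ≡⟨ interchange n m b ⟩
      (n + b) + (m + b)    ≤⟨ +-mono-≤ (≈∧<⇒+≤ (≈-sym ey) n<) (≈∧<⇒+≤ (≈-sym (cosum≈m pxs ex)) m<) ⟩
      sum ys + cosum xs       ∎))
      where
      open ≤-Reasoning
      regroup : ∀ N b → (2 + N) * b ≡ (N * b + b) + b
      regroup = solve-∀
      interchange : ∀ n m b → n + m + b + b ≡ (n + b) + (m + b)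
      interchange = solve-∀

    module _ (b≤1+N : b ≤ suc N) {w} (pw : S w) (inv : Invertible w)
             {k} (kw≤n : k * w ≤ n) (kw≈n : k * w ≈ n) where

      private x = proj₁ inv

      -- R lists the complements b ∸ q of the elements q of the multiset Q.
      module _ (R : List ℕ) (pR : All (S ∘ (b ∸_)) R) (R≤m : sum R ≤ m) (R≈m : sum R ≈ m) where

        -- The number of copies of `w`, below `b`, that completes the first `t` elements of Q to a
        -- sum ≡ `n`: `x` inverts `w`, and adding the complements b - q amounts to subtracting the
        -- q.
        s : ℕ → ℕ
        s t = ((n + sum (take t R)) * x) % b

        Z : ℕ → List ℕ
        Z t = map (b ∸_) (take t R) ++ replicate (s t) w

        R≤b : All (_≤ b) R
        R≤b = All.map cosum-S≤b pR

        Z⊆S : ∀ t → All S (Z t)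
        Z⊆S t = ++⁺ (map⁺ (take⁺ t pR)) (replicate⁺ (s t) pw)

        sum-Z : ∀ t → sum (Z t) ≡ cosum (take t R) + s t * w
        sum-Z t = trans (sum-++ (map (b ∸_) (take t R)) _) (cong (cosum (take t R) +_) (sum-replicate (s t) w))

        cosum-Z : ∀ t → cosum (Z t) ≡ sum (take t R) + s t * (b ∸ w)
        cosum-Z t = trans (cosum-++ (map (b ∸_) (take t R)) _)
          (cong₂ _+_ (cosum-map (take⁺ t R≤b)) (cosum-replicate (s t) w))

        *xw≈ : ∀ c → c * x * w ≈ c
        *xw≈ c = ≈-trans (≈-reflexive (regroup c x w)) (≈-trans (≈-*ʳ c (proj₂ inv)) (≈-reflexive (*-identityˡ c)))
          where
          regroup : ∀ c x w → c * x * w ≡ w * x * c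
          regroup = solve-∀

        sw≈ : ∀ t → s t * w ≈ n + sum (take t R)
        sw≈ t = ≈-trans (≈-*ʳ w (%-≈ ((n + sum (take t R)) * x))) (*xw≈ (n + sum (take t R)))

        sum-Z≈n : ∀ t → sum (Z t) ≈ n
        sum-Z≈n t = ≈-trans (≈-reflexive (sum-Z t)) (≈-trans (≈-+ (≈-refl {cosum (take t R)}) (sw≈ t))
          (≈-trans (≈-reflexive (regroup (cosum (take t R)) n (sum (take t R))))
            (≈-trans (≈-+ (≈-refl {n}) (cosum+sum≈0 (take⁺ t R≤b))) (≈-reflexive (+-identityʳ n)))))
          where
          regroup : ∀ p n q → p + (n + q) ≡ n + (p + q)
          regroup = solve-∀

        Shortening : Set
        Shortening = ∃ λ R′ → All (S ∘ (b ∸_)) R′ × sum R′ ≤ m × sum R′ ≈ m × length R′ < length R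

        -- Equal values of `s` force the window between `i` and `j` to have sum ≡ 0, so it can be
        -- cut out of `R`.
        repeat⇒shortening : ∀ {i j} → i < j → j ≤ length R → s i ≡ s j → Shortening
        repeat⇒shortening {i} {j} i<j j≤ e = cut i j R , cut⁺ i j pR ,
          ≤-trans (≤-trans (m≤m+n _ (sum (window i j R))) (≤-reflexive (sum-cut R i≤j))) R≤m ,
          ≈-trans (≈-cancelʳ window≈0 (≈-reflexive (trans (sum-cut R i≤j) (sym (+-identityʳ _))))) R≈m ,
          length-cut< R i<j j≤
          where
          i≤j = <⇒≤ i<j
          window≈0 : sum (window i j R) ≈ 0
          window≈0 = ≈-cancelʳ (≈-refl {n + sum (take i R)}) (≈-trans (≈-reflexive
            (trans (regroup (sum (window i j R)) n (sum (take i R))) (cong (n +_) (sum-window R i≤j))))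
            (≈-trans (≈-sym (sw≈ j)) (≈-trans (≈-reflexive (cong (_* w) (sym e))) (sw≈ i))))
            where
            regroup : ∀ p n q → p + (n + q) ≡ n + (q + p)
            regroup = solve-∀

        -- Invariant of the walk: `s` attains its minimum so far at `t`, and `Z t` meets the first
        -- box inequality.
        Record : ℕ → Set
        Record j = ∃ λ t → t ≤ j × sum (Z t) ≤ n × (∀ i → i ≤ j → s t ≤ s i)

        -- `Z 0` consists of `k % b` ≤ `k` copies of `w`.
        record₀ : Record 0
        record₀ = 0 , z≤n , ≤-trans sum-Z₀≤ kw≤n , λ { .0 z≤n → ≤-refl }
          where
          sum-Z₀≤ : sum (Z 0) ≤ k * w
          sum-Z₀≤ = ≤-trans (≤-reflexive (sum-replicate (s 0) w)) (*-monoˡ-≤ w (≤-trans (≤-reflexive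
            (≈⇒%≡ (≈-trans (≈-*ʳ x (≈-trans (≈-reflexive (+-identityʳ n)) (≈-sym kw≈n)))
              (≈-trans (≈-reflexive (regroup k w x)) (*xw≈ k))))) (m%n≤m k b)))
            where
            regroup : ∀ k w x → k * w * x ≡ k * x * w
            regroup = solve-∀

        -- The values s 0 , … , s j are distinct elements of [ s t , b ).
        distinct⇒bounded : ∀ {t j} → suc j ≤ length R → (∀ i → i ≤ j → s t ≤ s i) →
          suc j + s t ≤ b ⊎ Shortening
        distinct⇒bounded {t} {j} j< min with ≤-<-connex (suc j + s t) b
        ... | inj₁ le = inj₁ le
        ... | inj₂ gt with pigeonhole (m<n+o⇒m∸n<o b (s t) (subst (b <_) (+-comm (suc j) (s t)) gt))
          (λ i → fromℕ< (∸-monoˡ-< (m%n<n ((n + sum (take (toℕ i) R)) * x) b) (min (toℕ i) (s≤s⁻¹ (toℕ<n i)))))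
        ... | i , i′ , i<i′ , e = inj₂ (repeat⇒shortening i<i′ (≤-trans (<⇒≤ (toℕ<n i′)) j<)
          (∸-cancelʳ-≡ (min (toℕ i) (s≤s⁻¹ (toℕ<n i))) (min (toℕ i′) (s≤s⁻¹ (toℕ<n i′)))
            (fromℕ<-injective _ _ _ _ e)))

        -- Raising `s j` to `s t` and the prefix length `t` to `j` pairs every element with its own
        -- complement, for a total of (j + s t) b ≤ b b ≤ (1 + N) b.
        record-corner : ∀ {t j} → t ≤ j → s j < s t → j ≤ length R → j + s t ≤ b →
          sum (Z j) + cosum (Z t) < (2 + N) * b
        record-corner {t} {j} t≤j sj<st j≤ bound = begin-strict
          sum (Z j) + cosum (Z t)
            ≡⟨ cong₂ _+_ (sum-Z j) (cosum-Z t) ⟩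
          cosum (take j R) + s j * w + (sum (take t R) + s t * (b ∸ w))
            ≤⟨ +-mono-≤ (+-monoʳ-≤ (cosum (take j R)) (*-monoˡ-≤ w (<⇒≤ sj<st)))
                 (+-monoˡ-≤ (s t * (b ∸ w)) (sum-take-≤ R t≤j)) ⟩
          cosum (take j R) + s t * w + (sum (take j R) + s t * (b ∸ w))
            ≡⟨ regroup (cosum (take j R)) (s t) w (sum (take j R)) (b ∸ w) ⟩
          cosum (take j R) + sum (take j R) + s t * (b ∸ w + w)
            ≡⟨ cong₂ (λ p q → p + s t * q) (cosum+sum (take⁺ j R≤b)) (m∸n+n≡m (<⇒≤ (S<b pw))) ⟩
          length (take j R) * b + s t * b
            ≡⟨ cong (λ p → p * b + s t * b) (trans (length-take j R) (m≤n⇒m⊓n≡m j≤)) ⟩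
          j * b + s t * b
            ≡⟨ *-distribʳ-+ b j (s t) ⟨
          (j + s t) * b
            ≤⟨ *-monoˡ-≤ b (≤-trans bound b≤1+N) ⟩
          (1 + N) * b
            <⟨ *-monoˡ-< b (n<1+n (1 + N)) ⟩
          (2 + N) * b ∎
          where
          open ≤-Reasoning
          regroup : ∀ p s w q c → p + s * w + (q + s * c) ≡ p + q + s * (c + w)
          regroup = solve-∀

        next-record : ∀ {j} → suc j ≤ length R → Record j → (Box S n m ⊎ Shortening) ⊎ Record (suc j)
        next-record {j} j< (t , t≤j , Zt≤n , min) with ≤-<-connex (s t) (s (suc j))
        ... | inj₁ st≤ = inj₂ (t , m≤n⇒m≤1+n t≤j , Zt≤n , extend)
          where
          extend : ∀ i → i ≤ suc j → s t ≤ s i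
          extend i i≤ with m≤n⇒m<n∨m≡n i≤
          ... | inj₁ i< = min i (s≤s⁻¹ i<)
          ... | inj₂ refl = st≤
        ... | inj₂ <st with distinct⇒bounded {t} j< min
        ... | inj₂ shorter = inj₁ (inj₂ shorter)
        -- Either `Z t` also meets the second box inequality, or the new record `Z (suc j)` inherits
        -- the first one.
        ... | inj₁ bound with corner {ys = Z (suc j)} (Z⊆S t) (sum-Z≈n t) (sum-Z≈n (suc j))
                                (record-corner (m≤n⇒m≤1+n t≤j) <st j< bound)
        ... | inj₁ Zt≤m = inj₁ (inj₁ (Z t , Z⊆S t , Zt≤n , sum-Z≈n t , Zt≤m))
        ... | inj₂ Z≤n = inj₂ (suc j , ≤-refl , Z≤n , extend)
          where
          extend : ∀ i → i ≤ suc j → s (suc j) ≤ s i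
          extend i i≤ with m≤n⇒m<n∨m≡n i≤
          ... | inj₁ i< = ≤-trans (<⇒≤ <st) (min i (s≤s⁻¹ i<))
          ... | inj₂ refl = ≤-refl

        -- Since `n + sum R` ≡ n + m ≡ 0, the final value of `s` is 0, and so is the minimum `s t`.
        -- Then `Z t` is part of Q, and its cosum is at most `sum R`.
        last-record : Record (length R) → Box S n m
        last-record (t , t≤ , Zt≤n , min) = Z t , Z⊆S t , Zt≤n , sum-Z≈n t , (begin
          cosum (Z t)                          ≡⟨ cosum-Z t ⟩
          sum (take t R) + s t * (b ∸ w)    ≡⟨ cong (λ p → sum (take t R) + p * (b ∸ w)) st≡0 ⟩
          sum (take t R) + 0                ≡⟨ +-identityʳ _ ⟩
          sum (take t R)                    ≤⟨ sum-take-≤ R t≤ ⟩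
          sum (take (length R) R)           ≡⟨ cong sum take-R ⟩
          sum R                             ≤⟨ R≤m ⟩
          m                                 ∎)
          where
          open ≤-Reasoning
          take-R : take (length R) R ≡ R
          take-R = take-all (length R) R ≤-refl
          s-last : s (length R) ≡ 0
          s-last = trans (≈⇒%≡ {y = 0} (≈-*ʳ x (≈-trans (≈-reflexive (cong (λ R → n + sum R) take-R))
            (≈-trans (≈-+ (≈-refl {n}) R≈m) n+m≈0)))) (m*n%n≡0 0 b)
          st≡0 : s t ≡ 0
          st≡0 = n≤0⇒n≡0 (subst (s t ≤_) s-last (min (length R) ≤-refl))

        walk : ∀ j → j ≤ length R → (Box S n m ⊎ Shortening) ⊎ Record j
        walk zero    _  = inj₂ record₀
        walk (suc j) j< with walk j (<⇒≤ j<)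
        ... | inj₁ found = inj₁ found
        ... | inj₂ r     = next-record j< r

        box-or-shorten : Box S n m ⊎ Shortening
        box-or-shorten with walk (length R) ≤-refl
        ... | inj₁ found = found
        ... | inj₂ r     = inj₁ (last-record r)

      -- Induction on the length of `R` absorbs the shortenings.
      cyclic-box : ∀ R → All (S ∘ (b ∸_)) R → sum R ≤ m → sum R ≈ m → Box S n m
      cyclic-box R pR R≤m R≈m = go (length R) R pR R≤m R≈m ≤-refl
        where
        go : ∀ l R → All (S ∘ (b ∸_)) R → sum R ≤ m → sum R ≈ m → length R ≤ l → Box S n m
        go l R pR R≤m R≈m l≥ with box-or-shorten R pR R≤m R≈m
        ... | inj₁ box = box
        go zero    R _ _ _ l≥ | inj₂ (_ , _ , _ , _ , lt) = contradiction (≤-trans lt l≥) λ ()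
        go (suc l) R _ _ _ l≥ | inj₂ (R′ , pR′ , le , e , lt) = go l R′ pR′ le e (s≤s⁻¹ (≤-trans lt l≥))

-- Halving, decidability of membership in NA, and sums of members of A.

-- Turns N ≥ 2⌊b/2⌋ into b ≤ N + 1, the form that the cyclic case uses.
n≤1+2*[n/2] : ∀ n → n ≤ suc (2 * (n / 2))
n≤1+2*[n/2] n = begin
  n                    ≡⟨ m≡m%n+[m/n]*n n 2 ⟩
  n % 2 + n / 2 * 2    ≤⟨ +-mono-≤ (s≤s⁻¹ (m%n<n n 2)) (≤-reflexive (*-comm (n / 2) 2)) ⟩
  suc (2 * (n / 2))    ∎
  where open ≤-Reasoning

2*k≤n⇒k≤n/2 : ∀ {k n} → 2 * k ≤ n → k ≤ n / 2
2*k≤n⇒k≤n/2 {k} {n} le = subst (_≤ n / 2) (trans (cong (_/ 2) (*-comm 2 k)) (m*n/n≡m k 2)) (/-monoˡ-≤ 2 le)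

-- Exceptional sets are complements, so membership in NA is first reached under a double negation;
-- decidability removes it.
InSumset? : ∀ N A n → Dec (InSumset N A n)
InSumset? zero    A n = map′ (λ { refl → [] , refl , [] , refl }) (λ { ([] , refl , [] , refl) → refl }) (n ≟ 0)
InSumset? (suc N) A n =
  map′ to from (Any.any? (λ a → (a ≤? n) ×-dec InSumset? N A (n ∸ a)) A)
  where
  to : Any (λ a → a ≤ n × InSumset N A (n ∸ a)) A → InSumset (suc N) A n
  to p with find p
  ... | a , a∈A , a≤n , xs , refl , xs⊆A , e =
    a ∷ xs , refl , a∈A ∷ xs⊆A , trans (cong (a +_) e) (m+[n∸m]≡n a≤n)
  from : InSumset (suc N) A n → Any (λ a → a ≤ n × InSumset N A (n ∸ a)) A
  from (a ∷ xs , refl , a∈A ∷ xs⊆A , refl) =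
    lose a∈A (m≤m+n a (sum xs) , xs , refl , xs⊆A , sym (m+n∸m≡n a (sum xs)))

0∈P : ∀ A → InP A 0
0∈P A = replicate (length A) 0 , length-replicate (length A) , zeros A
  where
  zeros : ∀ A → sum (zipWith _*_ (replicate (length A) 0) A) ≡ 0
  zeros []      = refl
  zeros (_ ∷ A) = zeros A

P-+ : ∀ {A x n} → x ∈ A → InP A n → InP A (x + n)
P-+ {x ∷ A} (here refl) (c ∷ cs , len , e) =
  suc c ∷ cs , len , trans (+-assoc x (c * x) _) (cong (x +_) e)
P-+ {a ∷ A} {x} (there x∈A) (c ∷ cs , len , e)
  with P-+ x∈A (cs , suc-injective len , refl)
... | ds , len′ , e′ = c ∷ ds , cong suc len′ ,
  trans (cong (c * a +_) e′) (trans (left-comm (c * a) x _) (cong (x +_) e))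
  where
  left-comm : ∀ x y z → x + (y + z) ≡ y + (x + z)
  left-comm = solve-∀

members⇒InP : ∀ {A xs} → All (_∈ A) xs → InP A (sum xs)
members⇒InP {A} []       = 0∈P A
members⇒InP     (p ∷ ps) = P-+ p (members⇒InP ps)

-- From representations over A and b - A to box points and to NA.

module Structure (b : ℕ) .{{_ : NonZero b}} where

  open Congruence b
  open Reduction b
  open Chain b

  module _ {S : ℕ → Set} (S>0 : ∀ {a} → S a → 0 < a) (S<b : ∀ {a} → S a → a < b)
           {n m N : ℕ} (n+m≡ : n + m ≡ N * b) (2⌊b/2⌋≤N : 2 * (b / 2) ≤ N) where

    private
      S′ : ℕ → Set
      S′ = S ∘ (b ∸_)

      S′>0 : ∀ {r} → S′ r → 0 < r
      S′>0 {zero}  p = contradiction (S<b p) (<-irrefl refl)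
      S′>0 {suc r} p = z<s

      S′<b : ∀ {r} → S′ r → r < b
      S′<b p = m∸n≢0⇒n<m (m<n⇒n≢0 (S>0 p))

      m+n≡ : m + n ≡ N * b
      m+n≡ = trans (+-comm m n) n+m≡

      b≤1+N : b ≤ suc N
      b≤1+N = ≤-trans (n≤1+2*[n/2] b) (s≤s 2⌊b/2⌋≤N)

      -- Complementing every entry swaps sum and cosum, hence the two box inequalities.
      unflip : Box S′ m n → Box S n m
      unflip (zs , p , le , e , cosum≤) = map (b ∸_) zs , map⁺ p , cosum≤ ,
        cosum≈m S′ S′>0 S′<b {N = N} m+n≡ p e ,
        ≤-trans (≤-reflexive (cosum-map (All.map (<⇒≤ ∘ S′<b) p))) le

      -- Entries and complements are at most `b`, and the two lists have at most 2⌊b/2⌋ ≤ N entries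
      -- together, so `corner` applies: either P or Q is itself a box point.
      short-box : Short S n → Short S′ m → Box S n m
      short-box (xs , pxs , xs≤ , xs≈ , xs-short) (rs , prs , rs≤ , rs≈ , rs-short)
        with corner S S>0 S<b {N = N} n+m≡ {ys = map (b ∸_) rs} pxs xs≈
               (cosum≈m S′ S′>0 S′<b {N = N} m+n≡ prs rs≈) (begin-strict
          cosum rs + cosum xs
            ≤⟨ +-mono-≤ (cosum≤ (All.map (<⇒≤ ∘ S′<b) prs)) (cosum≤ (All.map (<⇒≤ ∘ S<b) pxs)) ⟩
          length rs * b + length xs * b
            ≡⟨ *-distribʳ-+ b (length rs) (length xs) ⟨
          (length rs + length xs) * b
            ≤⟨ *-monoˡ-≤ b (+-mono-≤ (2*k≤n⇒k≤n/2 {length rs} rs-short) (2*k≤n⇒k≤n/2 {length xs} xs-short)) ⟩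
          (b / 2 + b / 2) * b
            ≡⟨ cong (λ p → (b / 2 + p) * b) (+-identityʳ (b / 2)) ⟨
          2 * (b / 2) * b
            ≤⟨ *-monoˡ-≤ b 2⌊b/2⌋≤N ⟩
          N * b
            <⟨ *-monoˡ-< b (≤-trans (n<1+n N) (n≤1+n (1 + N))) ⟩
          (2 + N) * b ∎)
        where
        open ≤-Reasoning
        cosum≤ : ∀ {xs} → All (_≤ b) xs → cosum xs ≤ length xs * b
        cosum≤ {xs} ps = ≤-trans (m≤m+n (cosum xs) (sum xs)) (≤-reflexive (cosum+sum ps))
      ... | inj₁ cosum≤m  = xs , pxs , xs≤ , xs≈ , cosum≤m
      ... | inj₂ sum≤n = unflip (rs , prs , rs≤ , rs≈ , sum≤n)

    box : ∀ {xs rs} → All S xs → sum xs ≤ n → sum xs ≈ n → All S′ rs → sum rs ≤ m → sum rs ≈ m → Box S n m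
    box {xs} {rs} pxs xs≤ xs≈ prs rs≤ rs≈
      with short-or-cyclic S S>0 xs pxs xs≤ xs≈ | short-or-cyclic S′ S′>0 rs prs rs≤ rs≈
    ... | inj₁ short | inj₁ short′ = short-box short short′
    ... | inj₂ (w , k , pw , le , e , inv) | _ =
      cyclic-box S S>0 S<b n+m≡ b≤1+N pw inv {k} le e rs prs rs≤ rs≈
    -- Mirror image: Q is cyclic, (S, n) and (S′, m) trade places, and `xs` becomes the list of
    -- complements.
    ... | inj₁ _ | inj₂ (w , k , pw , le , e , inv) =
      unflip (cyclic-box S′ S′>0 S′<b m+n≡ b≤1+N pw inv {k} le e xs
        (All.map (λ p → subst S (sym (m∸[m∸n]≡n (<⇒≤ (S<b p)))) p) pxs) xs≤ xs≈)

  -- Copies of 0 and `b` are discarded: this keeps the residue and cannot raise the sum. `T` is the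
  -- interior of A or its reflection.
  InP⇒list : ∀ {T : ℕ → Set} {A n} → All (λ a → a ≡ 0 ⊎ a ≡ b ⊎ T a) A → InP A n →
    ∃ λ xs → All T xs × sum xs ≤ n × sum xs ≈ n
  InP⇒list {T} ps (cs , len , refl) = go ps cs len
    where
    go : ∀ {A} → All (λ a → a ≡ 0 ⊎ a ≡ b ⊎ T a) A → ∀ cs → length cs ≡ length A →
      ∃ λ xs → All T xs × sum xs ≤ sum (zipWith _*_ cs A) × sum xs ≈ sum (zipWith _*_ cs A)
    go [] [] _ = [] , [] , z≤n , ≈-refl
    go {_ ∷ A} (p ∷ ps) (c ∷ cs) len with go ps cs (suc-injective len) | p
    ... | xs , pxs , le , e | inj₁ refl = xs , pxs , ≤-trans le (m≤n+m _ (c * 0)) ,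
      ≈-trans e (≈-reflexive (cong (_+ sum (zipWith _*_ cs A)) (sym (*-zeroʳ c))))
    ... | xs , pxs , le , e | inj₂ (inj₁ refl) = xs , pxs , ≤-trans le (m≤n+m _ (c * b)) ,
      ≈-+ (≈-sym (multiple≈0 c)) e
    ... | xs , pxs , le , e | inj₂ (inj₂ pa) = replicate c _ ++ xs , ++⁺ (replicate⁺ c pa) pxs ,
      ≤-trans (≤-reflexive (sum-replicate-++ c _ xs)) (+-monoʳ-≤ (c * _) le) ,
      ≈-trans (≈-reflexive (sum-replicate-++ c _ xs)) (≈-+ (≈-refl {c * _}) e)

  module _ {A : List ℕ} (0∈A : 0 ∈ A) (b∈A : b ∈ A) (A≤b : All (_≤ b) A) where

    Interior : ℕ → Set
    Interior a = a ∈ A × 0 < a × a < b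

    classify : ∀ {a} → a ∈ A → a ≡ 0 ⊎ a ≡ b ⊎ Interior a
    classify {a} a∈A with m≤n⇒m<n∨m≡n (z≤n {a}) | m≤n⇒m<n∨m≡n (All.lookup A≤b a∈A)
    ... | inj₂ 0≡a | _        = inj₁ (sym 0≡a)
    ... | inj₁ _   | inj₂ a≡b = inj₂ (inj₁ a≡b)
    ... | inj₁ 0<a | inj₁ a<b = inj₂ (inj₂ (a∈A , 0<a , a<b))

    classify-shift : ∀ {a} → a ∈ A → b ∸ a ≡ 0 ⊎ b ∸ a ≡ b ⊎ Interior (b ∸ (b ∸ a))
    classify-shift {a} a∈A with classify a∈A
    ... | inj₁ refl        = inj₂ (inj₁ refl)
    ... | inj₂ (inj₁ refl) = inj₁ (n∸n≡0 b)
    ... | inj₂ (inj₂ p)    =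
      inj₂ (inj₂ (subst Interior (sym (m∸[m∸n]≡n (All.lookup A≤b a∈A))) p))

    -- The sum is filled up to `n` by copies of `b`, and the cosum up to `m` by copies of 0.
    box⇒InSumset : ∀ {N n m} → n + m ≡ N * b → Box Interior n m → InSumset N A n
    box⇒InSumset {N} {n} {m} n+m≡ (zs , p , le , e , cosum≤m)
      with ≈∧≤⇒+ e le
         | ≈∧≤⇒+ (cosum≈m Interior (proj₁ ∘ proj₂) (proj₂ ∘ proj₂) {N = N} n+m≡ p e) cosum≤m
    ... | j , zs+j≡n | j′ , cosum+j′≡m =
      zs ++ pads , length≡ , ++⁺ (All.map proj₁ p) (++⁺ (replicate⁺ j b∈A) (replicate⁺ j′ 0∈A)) ,
      sum≡
      where
      open ≡-Reasoning
      pads = replicate j b ++ replicate j′ 0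
      sum≡ : sum (zs ++ pads) ≡ n
      sum≡ = begin
        sum (zs ++ pads)                ≡⟨ sum-++ zs pads ⟩
        sum zs + sum pads               ≡⟨ cong (sum zs +_) (sum-replicate-++ j b (replicate j′ 0)) ⟩
        sum zs + (j * b + sum (replicate j′ 0))
          ≡⟨ cong (λ q → sum zs + (j * b + q)) (trans (sum-replicate j′ 0) (*-zeroʳ j′)) ⟩
        sum zs + (j * b + 0)            ≡⟨ cong (sum zs +_) (+-identityʳ (j * b)) ⟩
        sum zs + j * b                  ≡⟨ zs+j≡n ⟩
        n                               ∎
      length≡ : length (zs ++ pads) ≡ N
      -- Each entry adds exactly `b` to sum plus cosum, so n + m = N b fixes the number of entries.
      length≡ = *-cancelʳ-≡ _ N b (begin
        length (zs ++ pads) * b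
          ≡⟨ cong (_* b) (trans (length-++ zs) (cong (length zs +_)
               (trans (length-++ (replicate j b)) (cong₂ _+_ (length-replicate j) (length-replicate j′))))) ⟩
        (length zs + (j + j′)) * b
          ≡⟨ distrib (length zs) j j′ b ⟩
        length zs * b + (j * b + j′ * b)
          ≡⟨ cong (_+ (j * b + j′ * b)) (cosum+sum (All.map (<⇒≤ ∘ proj₂ ∘ proj₂) p)) ⟨
        cosum zs + sum zs + (j * b + j′ * b)
          ≡⟨ interchange (cosum zs) (sum zs) (j * b) (j′ * b) ⟩
        (sum zs + j * b) + (cosum zs + j′ * b)
          ≡⟨ cong₂ _+_ zs+j≡n cosum+j′≡m ⟩
        n + m
          ≡⟨ n+m≡ ⟩
        N * b ∎)
        where
        distrib : ∀ l j j′ b → (l + (j + j′)) * b ≡ l * b + (j * b + j′ * b)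
        distrib = solve-∀
        interchange : ∀ c s j j′ → c + s + (j + j′) ≡ (s + j) + (c + j′)
        interchange = solve-∀

    InP∧InP⇒InSumset : ∀ {N n m} → n + m ≡ N * b → 2 * (b / 2) ≤ N →
      InP A n → InP (shift b A) m → InSumset N A n
    InP∧InP⇒InSumset {N} {n} {m} n+m≡ 2⌊b/2⌋≤N n∈P m∈P
      with InP⇒list (All.tabulate classify) n∈P
         | InP⇒list {T = Interior ∘ (b ∸_)} (map⁺ (All.tabulate classify-shift)) m∈P
    ... | xs , pxs , xs≤ , xs≈ | rs , prs , rs≤ , rs≈ = box⇒InSumset n+m≡
      (box (proj₁ ∘ proj₂) (proj₂ ∘ proj₂) n+m≡ 2⌊b/2⌋≤N pxs xs≤ xs≈ prs rs≤ rs≈)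

    -- The complements of the `N` summands represent N b - n over b - A.
    InSumset⇒InP-shift : ∀ {N n} → InSumset N A n → ∃ λ m → m + n ≡ N * b × InP (shift b A) m
    InSumset⇒InP-shift (xs , refl , xs⊆A , refl) = cosum xs , cosum+sum (All.map (All.lookup A≤b) xs⊆A) ,
      members⇒InP (map⁺ (All.map (∈-map⁺ (b ∸_)) xs⊆A))

-- The two inclusions of the set equality.

theorem1 : (A : List ℕ) (b N : ℕ) → 0 ∈ A → b ∈ A → All (_≤ b) A → 1 ≤ b →
    gcdList A ≡ 1 → 1 ≤ N → 2 * (b / 2) ≤ N →
    ((n : ℕ) → n ≤ N * b →
    ¬ (InE A n ⊎ InReflect (N * b) (InE (shift b A)) n) → InSumset N A n)
    × ((n : ℕ) → InSumset N A n →
    n ≤ N * b × ¬ (InE A n ⊎ InReflect (N * b) (InE (shift b A)) n))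
theorem1 A b N 0∈A b∈A A≤b 1≤b _ _ 2⌊b/2⌋≤N = sufficient , necessary
  where
  instance
    b≢0 : NonZero b
    b≢0 = >-nonZero 1≤b
  open Structure b

  sufficient : ∀ n → n ≤ N * b →
    ¬ (InE A n ⊎ InReflect (N * b) (InE (shift b A)) n) → InSumset N A n
  -- Assuming n ∉ NA, representations of `n` over A and of `N * b ∸ n` over b - A cannot coexist, so
  -- `n` lies in one of the excluded sets up to double negation.
  sufficient n n≤Nb n∉ = decidable-stable (InSumset? N A n) λ n∉NA →
    n∉ (inj₁ λ n∈P → n∉ (inj₂ (N * b ∸ n , (λ m∈P → n∉NA
      (InP∧InP⇒InSumset 0∈A b∈A A≤b (m+[n∸m]≡n n≤Nb) 2⌊b/2⌋≤N n∈P m∈P)) , m∸n+n≡m n≤Nb)))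

  necessary : ∀ n → InSumset N A n →
    n ≤ N * b × ¬ (InE A n ⊎ InReflect (N * b) (InE (shift b A)) n)
  necessary n n∈NA with InSumset⇒InP-shift 0∈A b∈A A≤b n∈NA
  ... | m , m+n≡ , m∈P = ≤-trans (m≤n+m n m) (≤-reflexive m+n≡) , λ
    { (inj₁ n∉P) → n∉P (let _ , _ , xs⊆A , e = n∈NA in subst (InP A) e (members⇒InP xs⊆A))
    ; (inj₂ (x , x∉P , x+n≡)) →
        x∉P (subst (InP (shift b A)) (+-cancelʳ-≡ n m x (trans m+n≡ (sym x+n≡))) m∈P) }
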